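{- Let $\mathfrak{M}$ be a model, $x$ a variable, $f$ any Boolean expression in $n$ arguments, $\theta,\varphi_1,\dots,\varphi_n$ formulas, $z_1,\dots,z_m$ variables distinct from $x$ none of which occurs free in $\theta$, and $Q_1,\dots,Q_m\in\{\forall,\exists\}$. If every $\varphi_i$ is non-dependent of $x$ in $\mathfrak{M}$ provided $\theta$, then $$[\![\exists x\theta\to Q_mz_m\dots Q_1z_1\,f\big(\forall x(\theta\to\varphi_1),\dots,\forall x(\theta\to\varphi_n)\big)]\!]^{\mathfrak{M}}=[\![\forall x\big(\theta\to Q_mz_m\dots Q_1z_1\,f(\varphi_1,\dots,\varphi_n)\big)]\!]^{\mathfrak{M}},$$ and hence, if moreover $\mathfrak{M}\models\exists x\theta$, then $$[\![Q_mz_m\dots Q_1z_1\,f\big(\forall x(\theta\to\varphi_1),\dots,\forall x(\theta\to\varphi_n)\big)]\!]^{\mathfrak{M}}=[\![\forall x\big(\theta\to Q_mz_m\dots Q_1z_1\,f(\varphi_1,\dots,\varphi_n)\big)]\!]^{\mathfrak{M}}.$$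
   Context: Work in first-order logic with equality over a relational signature, with countably many variables $v_1,v_2,\dots$. A model $\mathfrak{M}$ has nonempty universe $M$; assignments are $\bar a\in M^\omega$ ($a_i$ is the value of $v_i$); for $x=v_i$, $b\in M$, $\bar a^x_b$ is $\bar a$ with $i$-th entry replaced by $b$. $[\![\varphi]\!]^{\mathfrak{M}}=\{\bar a\in M^\omega:\mathfrak{M}\models\varphi[\bar a]\}$; $\mathfrak{M}\models\chi$ means every $\bar a$ satisfies $\chi$. A Boolean expression is built from its arguments using $\neg$ and $\land$ (and hence any Boolean connectives). Definition: $\varphi$ is non-dependent of $x$ in $\mathfrak{M}$ provided $\theta$ iff for all $\bar a\in M^\omega$, $b\in M$: if $\mathfrak{M}\models\theta[\bar a]$ and $\mathfrak{M}\models\theta[\bar a^x_b]$ then ($\mathfrak{M}\models\varphi[\bar a]\iff\mathfrak{M}\models\varphi[\bar a^x_b]$). -}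

module Defs where

open import Level using (Level; _⊔_) renaming (suc to lsuc)
open import Data.Bool.Base using (if_then_else_)
open import Data.Fin.Base using (Fin)
open import Data.Nat.Base using (ℕ; zero; suc)
open import Data.Nat.Properties using (_≟_)
open import Data.Product.Base using (_×_; ∃)
open import Data.Sum.Base using (_⊎_)
open import Data.Vec.Base using (Vec; map)
open import Data.Vec.Functional using (Vector; head; tail)
open import Data.Vec.Membership.Propositional using (_∈_)
open import Function.Bundles using (_⇔_)
open import Relation.Binary.PropositionalEquality using (_≡_; _≢_)
open import Relation.Nullary using (¬_; does)
open import Relation.Unary using (Pred)

record Signature (s : Level) : Set (lsuc s) where
  field
    Symbol : Set s
    arity  : Symbol → ℕ

Var : Set
Var = ℕ

infix  9 _`≡_
infix  8 `¬_
infixr 7 _`∧_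
infixr 6 _`∨_
infixr 5 _`⇒_

-- All connectives and both quantifiers are primitive: the usual classical
-- abbreviations (such as φ → ψ for ¬(φ ∧ ¬ψ)) would change the meaning of a
-- formula under the Set-valued semantics below unless excluded middle holds.
data Formula {s} (S : Signature s) : Set s where
  rel        : (R : Signature.Symbol S) → Vec Var (Signature.arity S R) → Formula S
  _`≡_       : Var → Var → Formula S
  `¬_        : Formula S → Formula S
  _`∧_ _`∨_  : Formula S → Formula S → Formula S
  _`⇒_       : Formula S → Formula S → Formula S
  `∀ `∃      : Var → Formula S → Formula S

data Quantifier : Set where
  all ex : Quantifier

-- For the same reason ∨ and → are given as connectives of their own, in
-- addition to ¬ and ∧.
data BoolExpr (n : ℕ) : Set where
  arg        : Fin n → BoolExpr n
  `¬_        : BoolExpr n → BoolExpr n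
  _`∧_ _`∨_  : BoolExpr n → BoolExpr n → BoolExpr n
  _`⇒_       : BoolExpr n → BoolExpr n → BoolExpr n

module _ {s : Level} {S : Signature s} where

  apply : ∀ {n} → BoolExpr n → Vector (Formula S) n → Formula S
  apply (arg i)  φ = φ i
  apply (`¬ f)   φ = `¬ apply f φ
  apply (f `∧ g) φ = apply f φ `∧ apply g φ
  apply (f `∨ g) φ = apply f φ `∨ apply g φ
  apply (f `⇒ g) φ = apply f φ `⇒ apply g φ

  quantify : Quantifier → Var → Formula S → Formula S
  quantify all = `∀
  quantify ex  = `∃

  -- prefix Q z ψ is Q_m z_m … Q_1 z_1 ψ: the head of the vectors is the
  -- innermost quantifier.
  prefix : ∀ {m} → Vector Quantifier m → Vector Var m → Formula S → Formula S
  prefix {zero}  Q z ψ = ψ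
  prefix {suc m} Q z ψ = prefix (tail Q) (tail z) (quantify (head Q) (head z) ψ)

  infix 4 _FreeIn_

  _FreeIn_ : Var → Formula S → Set
  y FreeIn rel R xs = y ∈ xs
  y FreeIn (u `≡ v) = y ≡ u ⊎ y ≡ v
  y FreeIn (`¬ φ)   = y FreeIn φ
  y FreeIn (φ `∧ ψ) = y FreeIn φ ⊎ y FreeIn ψ
  y FreeIn (φ `∨ ψ) = y FreeIn φ ⊎ y FreeIn ψ
  y FreeIn (φ `⇒ ψ) = y FreeIn φ ⊎ y FreeIn ψ
  y FreeIn `∀ x φ   = y ≢ x × y FreeIn φ
  y FreeIn `∃ x φ   = y ≢ x × y FreeIn φ

record Model {s} (S : Signature s) (ℓ : Level) : Set (s ⊔ lsuc ℓ) where
  open Signature S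
  field
    Universe : Set ℓ
    nonempty : Universe
    interp   : (R : Symbol) → Pred (Vec Universe (arity R)) ℓ

  Assignment : Set ℓ
  Assignment = Var → Universe

open Model using (Universe; interp; Assignment)

_[_↦_] : ∀ {ℓ} {M : Set ℓ} → (Var → M) → Var → M → (Var → M)
(a [ x ↦ b ]) y = if does (y ≟ x) then b else a y

module _ {s ℓ : Level} {S : Signature s} where

  infix 4 _⊨_[_] _⊨_

  _⊨_[_] : (𝔐 : Model S ℓ) → Formula S → Assignment 𝔐 → Set ℓ
  𝔐 ⊨ rel R xs [ a ] = interp 𝔐 R (map a xs)
  𝔐 ⊨ u `≡ v   [ a ] = a u ≡ a v
  𝔐 ⊨ `¬ φ     [ a ] = ¬ (𝔐 ⊨ φ [ a ])
  𝔐 ⊨ φ `∧ ψ   [ a ] = (𝔐 ⊨ φ [ a ]) × (𝔐 ⊨ ψ [ a ])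
  𝔐 ⊨ φ `∨ ψ   [ a ] = (𝔐 ⊨ φ [ a ]) ⊎ (𝔐 ⊨ ψ [ a ])
  𝔐 ⊨ φ `⇒ ψ   [ a ] = 𝔐 ⊨ φ [ a ] → 𝔐 ⊨ ψ [ a ]
  𝔐 ⊨ `∀ x φ   [ a ] = (b : Universe 𝔐) → 𝔐 ⊨ φ [ a [ x ↦ b ] ]
  𝔐 ⊨ `∃ x φ   [ a ] = ∃ λ (b : Universe 𝔐) → 𝔐 ⊨ φ [ a [ x ↦ b ] ]

  _⊨_ : Model S ℓ → Formula S → Set ℓ
  𝔐 ⊨ χ = ∀ a → 𝔐 ⊨ χ [ a ]

  ⟦_⟧^_ : Formula S → (𝔐 : Model S ℓ) → Pred (Assignment 𝔐) ℓ
  (⟦ φ ⟧^ 𝔐) a = 𝔐 ⊨ φ [ a ]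

  NonDependent : Model S ℓ → Var → (θ φ : Formula S) → Set ℓ
  NonDependent 𝔐 x θ φ = ∀ a b →
    𝔐 ⊨ θ [ a ] → 𝔐 ⊨ θ [ a [ x ↦ b ] ] →
    (𝔐 ⊨ φ [ a ]) ⇔ (𝔐 ⊨ φ [ a [ x ↦ b ] ])

{-# OPTIONS --safe #-}
-- At an assignment satisfying θ, non-dependence makes ∀x(θ → φᵢ) equivalent to
-- φᵢ. This equivalence relative to θ passes through Boolean connectives, and
-- through quantifiers over variables not free in θ, since those do not affect
-- the truth of θ. As x is not free in the left-hand formula, its truth value at
-- any θ-witness a[x ↦ b] is the one at a.
module Submission where

open import Data.Fin.Base using (zero; suc)
open import Data.Nat.Base using (ℕ; zero; suc)
open import Data.Nat.Properties using (_≟_)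
open import Data.Product.Base using (_×_; _,_; proj₁; proj₂; map₂)
open import Data.Product.Function.NonDependent.Propositional using (_×-⇔_)
open import Data.Sum.Base using (inj₁; inj₂; [_,_])
open import Data.Sum.Function.Propositional using (_⊎-⇔_)
open import Data.Vec.Base using (Vec; []; _∷_; map)
open import Data.Vec.Functional using (Vector; head; tail)
open import Data.Vec.Membership.Propositional using (_∈_)
open import Data.Vec.Relation.Unary.Any using (here; there)
open import Function.Base using (_∘_)
open import Function.Bundles using (_⇔_; mk⇔; module Equivalence)
open import Function.Related.TypeIsomorphisms using (→-cong-⇔; ¬-cong-⇔)
open import Relation.Binary.PropositionalEquality
  using (_≡_; _≢_; refl; sym; trans; cong₂; subst)
open import Relation.Nullary using (¬_; yes; no)
open import Relation.Nullary.Decidable using (dec-true; dec-false)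
open import Relation.Unary using (_≐_)
open import Defs

open Equivalence using (to; from)
open Model using (interp; Assignment)

map-cong-∈ : ∀ {a b} {A : Set a} {B : Set b} {f g : A → B} {n} (xs : Vec A n) →
             (∀ {x} → x ∈ xs → f x ≡ g x) → map f xs ≡ map g xs
map-cong-∈ []       eq = refl
map-cong-∈ (x ∷ xs) eq = cong₂ _∷_ (eq (here refl)) (map-cong-∈ xs (eq ∘ there))

module _ {ℓ} {M : Set ℓ} where

  update-updates : ∀ (a : Var → M) x b → (a [ x ↦ b ]) x ≡ b
  update-updates a x b rewrite dec-true (x ≟ x) refl = refl

  update-minimal : ∀ (a : Var → M) {x b y} → y ≢ x → (a [ x ↦ b ]) y ≡ a y
  update-minimal a {x} {b} {y} y≢x rewrite dec-false (y ≟ x) y≢x = refl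

  -- The update overwrites the value at `x`, so earlier agreement matters only elsewhere. This
  -- matches the clause `y ≢ x` in freeness under a quantifier.
  update-cong : ∀ (a a′ : Var → M) x b {y} → (y ≢ x → a y ≡ a′ y) →
                (a [ x ↦ b ]) y ≡ (a′ [ x ↦ b ]) y
  update-cong a a′ x b {y} eq with y ≟ x
  ... | yes refl = trans (update-updates a x b) (sym (update-updates a′ x b))
  ... | no  y≢x  =
    trans (update-minimal a y≢x) (trans (eq y≢x) (sym (update-minimal a′ y≢x)))

  -- Pointwise, because equality of the two assignments as functions would require function
  -- extensionality; `coincidence` consumes the pointwise form.
  update-id : ∀ (a : Var → M) x y → (a [ x ↦ a x ]) y ≡ a y
  update-id a x y with y ≟ x
  ... | yes refl = update-updates a x (a x)
  ... | no  y≢x  = update-minimal a y≢x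

module _ {s} {S : Signature s} where

  apply-FreeIn : ∀ {y n} (f : BoolExpr n) {φ : Vector (Formula S) n} →
                 (∀ i → ¬ (y FreeIn φ i)) → ¬ (y FreeIn apply f φ)
  apply-FreeIn (arg i)  y∉φ = y∉φ i
  apply-FreeIn (`¬ f)   y∉φ = apply-FreeIn f y∉φ
  apply-FreeIn (f `∧ g) y∉φ = [ apply-FreeIn f y∉φ , apply-FreeIn g y∉φ ]
  apply-FreeIn (f `∨ g) y∉φ = [ apply-FreeIn f y∉φ , apply-FreeIn g y∉φ ]
  apply-FreeIn (f `⇒ g) y∉φ = [ apply-FreeIn f y∉φ , apply-FreeIn g y∉φ ]

  quantify-FreeIn : ∀ {y} q {z} {ψ : Formula S} →
                    ¬ (y FreeIn ψ) → ¬ (y FreeIn quantify q z ψ)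
  quantify-FreeIn all y∉ψ (_ , y∈ψ) = y∉ψ y∈ψ
  quantify-FreeIn ex  y∉ψ (_ , y∈ψ) = y∉ψ y∈ψ

  prefix-FreeIn : ∀ {y m} (Q : Vector Quantifier m) (z : Vector Var m) {ψ : Formula S} →
                  ¬ (y FreeIn ψ) → ¬ (y FreeIn prefix Q z ψ)
  prefix-FreeIn {m = zero}  Q z y∉ψ = y∉ψ
  prefix-FreeIn {m = suc m} Q z y∉ψ =
    prefix-FreeIn (tail Q) (tail z) (quantify-FreeIn (head Q) y∉ψ)

module _ {s ℓ} {S : Signature s} (𝔐 : Model S ℓ) where

  -- Induction on `φ`, with the assignments left general: under a quantifier both are updated by the
  -- same `b`, which restores agreement at the bound variable.
  coincidence : ∀ (φ : Formula S) {a a′ : Assignment 𝔐} →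
                (∀ {y} → y FreeIn φ → a y ≡ a′ y) →
                (𝔐 ⊨ φ [ a ]) ⇔ (𝔐 ⊨ φ [ a′ ])
  coincidence (rel R xs) eq =
    mk⇔ (subst (interp 𝔐 R) eqs) (subst (interp 𝔐 R) (sym eqs))
    where eqs = map-cong-∈ xs eq
  coincidence (u `≡ v) eq =
    mk⇔ (λ p → trans (sym equ) (trans p eqv)) (λ p → trans equ (trans p (sym eqv)))
    where equ = eq (inj₁ refl)
          eqv = eq (inj₂ refl)
  coincidence (`¬ φ)   eq = ¬-cong-⇔ (coincidence φ eq)
  coincidence (φ `∧ ψ) eq = coincidence φ (eq ∘ inj₁) ×-⇔ coincidence ψ (eq ∘ inj₂)
  coincidence (φ `∨ ψ) eq = coincidence φ (eq ∘ inj₁) ⊎-⇔ coincidence ψ (eq ∘ inj₂)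
  coincidence (φ `⇒ ψ) eq = →-cong-⇔ (coincidence φ (eq ∘ inj₁)) (coincidence ψ (eq ∘ inj₂))
  coincidence (`∀ x φ) {a} {a′} eq = mk⇔ (λ h b → to (body b) (h b)) (λ h b → from (body b) (h b))
    where
    body : ∀ b → (𝔐 ⊨ φ [ a [ x ↦ b ] ]) ⇔ (𝔐 ⊨ φ [ a′ [ x ↦ b ] ])
    body b = coincidence φ λ y∈φ → update-cong a a′ x b λ y≢x → eq (y≢x , y∈φ)
  coincidence (`∃ x φ) {a} {a′} eq = mk⇔ (map₂ (to (body _))) (map₂ (from (body _)))
    where
    body : ∀ b → (𝔐 ⊨ φ [ a [ x ↦ b ] ]) ⇔ (𝔐 ⊨ φ [ a′ [ x ↦ b ] ])
    body b = coincidence φ λ y∈φ → update-cong a a′ x b λ y≢x → eq (y≢x , y∈φ)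

  coincidence-update : ∀ (φ : Formula S) {x} → ¬ (x FreeIn φ) → ∀ a b →
                       (𝔐 ⊨ φ [ a [ x ↦ b ] ]) ⇔ (𝔐 ⊨ φ [ a ])
  coincidence-update φ x∉φ a b =
    coincidence φ λ y∈φ → update-minimal a λ { refl → x∉φ y∈φ }

  -- The assignment is quantified here, not fixed, since passing under a quantifier moves from `a`
  -- to `a [ z ↦ b ]`.
  EquivalentUnder : (θ ψ χ : Formula S) → Set ℓ
  EquivalentUnder θ ψ χ = ∀ a → 𝔐 ⊨ θ [ a ] → (𝔐 ⊨ ψ [ a ]) ⇔ (𝔐 ⊨ χ [ a ])

  module _ (θ : Formula S) where

    relativise : ∀ {x} φ → NonDependent 𝔐 x θ φ →
                 EquivalentUnder θ (`∀ x (θ `⇒ φ)) φ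
    relativise {x} φ nd a θa = mk⇔
      -- The instance at `b = a x` updates `a` to an assignment pointwise equal to it, where `θ`
      -- still holds.
      (λ h → to (coincidence φ λ _ → update-id a x _)
               (h (a x) (from (coincidence θ λ _ → update-id a x _) θa)))
      -- Non-dependence carries `φ` from `a` to any other value of `x` satisfying `θ`.
      (λ φa b θb → to (nd a b θa θb) φa)

    apply-cong : ∀ {n} (f : BoolExpr n) (φ ψ : Vector (Formula S) n) →
                 (∀ i → EquivalentUnder θ (φ i) (ψ i)) →
                 EquivalentUnder θ (apply f φ) (apply f ψ)
    apply-cong (arg i)  φ ψ eq a θa = eq i a θa
    apply-cong (`¬ f)   φ ψ eq a θa = ¬-cong-⇔ (apply-cong f φ ψ eq a θa)
    apply-cong (f `∧ g) φ ψ eq a θa = apply-cong f φ ψ eq a θa ×-⇔ apply-cong g φ ψ eq a θa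
    apply-cong (f `∨ g) φ ψ eq a θa = apply-cong f φ ψ eq a θa ⊎-⇔ apply-cong g φ ψ eq a θa
    apply-cong (f `⇒ g) φ ψ eq a θa = →-cong-⇔ (apply-cong f φ ψ eq a θa) (apply-cong g φ ψ eq a θa)

    -- Changing the value of `z` preserves `θ`, so the assumed equivalence is available at every
    -- `a [ z ↦ b ]`.
    quantify-cong : ∀ q {z} ψ χ → ¬ (z FreeIn θ) → EquivalentUnder θ ψ χ →
                    EquivalentUnder θ (quantify q z ψ) (quantify q z χ)
    quantify-cong q {z} ψ χ z∉θ eq a θa = go q
      where
      body : ∀ b → (𝔐 ⊨ ψ [ a [ z ↦ b ] ]) ⇔ (𝔐 ⊨ χ [ a [ z ↦ b ] ])
      body b = eq (a [ z ↦ b ]) (from (coincidence-update θ z∉θ a b) θa)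

      go : ∀ q → (𝔐 ⊨ quantify q z ψ [ a ]) ⇔ (𝔐 ⊨ quantify q z χ [ a ])
      go all = mk⇔ (λ h b → to (body b) (h b)) (λ h b → from (body b) (h b))
      go ex  = mk⇔ (map₂ (to (body _))) (map₂ (from (body _)))

    prefix-cong : ∀ {m} (Q : Vector Quantifier m) (z : Vector Var m) ψ χ →
                  (∀ j → ¬ (z j FreeIn θ)) → EquivalentUnder θ ψ χ →
                  EquivalentUnder θ (prefix Q z ψ) (prefix Q z χ)
    prefix-cong {zero}  Q z ψ χ z∉θ eq = eq
    prefix-cong {suc m} Q z ψ χ z∉θ eq =
      -- The head is the innermost quantifier, so it is absorbed into the two matrices before the
      -- recursion.
      prefix-cong (tail Q) (tail z) _ _ (z∉θ ∘ suc)
        (quantify-cong (head Q) ψ χ (z∉θ zero) eq)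

    -- At a `θ`-witness `a [ x ↦ b ]` the formulas `ψ` and `χ` agree, and there `ψ` has the truth
    -- value it has at `a`. Each such `b` also proves the antecedent `∃xθ`.
    ∃⇒-≐-∀⇒ : ∀ {x} ψ χ → ¬ (x FreeIn ψ) → EquivalentUnder θ ψ χ →
              ⟦ `∃ x θ `⇒ ψ ⟧^ 𝔐 ≐ ⟦ `∀ x (θ `⇒ χ) ⟧^ 𝔐
    ∃⇒-≐-∀⇒ ψ χ x∉ψ eq =
        (λ {a} h b θb → to (eq _ θb) (from (coincidence-update ψ x∉ψ a b) (h (b , θb))))
      , (λ { {a} h (b , θb) → to (coincidence-update ψ x∉ψ a b) (from (eq _ θb) (h b θb)) })

mainTheorem10 : ∀ {s ℓ} (S : Signature s) (𝔐 : Model S ℓ) (x : Var)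
    (n : ℕ) (f : BoolExpr n) (θ : Formula S) (φ : Vector (Formula S) n)
    (m : ℕ) (z : Vector Var m) (Q : Vector Quantifier m) →
    (∀ j → z j ≢ x) →
    (∀ j → ¬ (z j FreeIn θ)) →
    (∀ i → NonDependent 𝔐 x θ (φ i)) →
    (⟦ `∃ x θ `⇒ prefix Q z (apply f (λ i → `∀ x (θ `⇒ φ i))) ⟧^ 𝔐
    ≐ ⟦ `∀ x (θ `⇒ prefix Q z (apply f φ)) ⟧^ 𝔐)
    × (𝔐 ⊨ `∃ x θ →
    ⟦ prefix Q z (apply f (λ i → `∀ x (θ `⇒ φ i))) ⟧^ 𝔐
    ≐ ⟦ `∀ x (θ `⇒ prefix Q z (apply f φ)) ⟧^ 𝔐)
mainTheorem10 S 𝔐 x n f θ φ m z Q z≢x z∉θ nd =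
  -- For the second equality, `∃θ a` discharges the antecedent in one direction; in the other, the
  -- conclusion is weakened to a constant implication.
  main , λ ∃θ → (λ {a} h → sub {a} λ _ → h) , (λ {a} h → sup {a} h (∃θ a))
  where
  φ∀ = λ i → `∀ x (θ `⇒ φ i)
  lhs = prefix Q z (apply f φ∀)

  x∉lhs : ¬ (x FreeIn lhs)
  -- Each argument of `f` binds `x`, and neither connectives nor quantifiers create new free
  -- variables.
  x∉lhs = prefix-FreeIn Q z (apply-FreeIn f λ i (x≢x , _) → x≢x refl)

  lhs⇔rhs : EquivalentUnder 𝔐 θ lhs (prefix Q z (apply f φ))
  lhs⇔rhs = prefix-cong 𝔐 θ Q z _ _ z∉θ
    (apply-cong 𝔐 θ f φ∀ φ λ i → relativise 𝔐 θ (φ i) (nd i))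

  main = ∃⇒-≐-∀⇒ 𝔐 θ lhs (prefix Q z (apply f φ)) x∉lhs lhs⇔rhs
  sub = main .proj₁
  sup = main .proj₂
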